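{- For every positive integer $k$, Algorithm GREEDY (described below) is a polynomial-time $2$-approximation algorithm for \textsc{MaxStarExp($k$)}, running in time $\Theta(kn^2)$ on a temporal star with $n$ vertices: it always returns a (partial) exploration $A$ with $|OPT|\le 2|A|$, where $|OPT|$ is the maximum size of a (partial) exploration. Moreover the ratio is tight: there is an instance on which the optimum size is $2$ and Algorithm GREEDY returns an exploration of size $1$.
   Context: A temporal star $(G_s,L)$ consists of a star $G_s$ with center $c$ and a map $L$ assigning to each edge a finite set of positive integer labels (times at which the edge is available). A journey is a sequence of time edges $(u,u_1,l_1),(u_1,u_2,l_2),\dots$, each $l_t$ a label of the edge traversed, with strictly increasing labels. A (partial) exploration is a journey starting and ending at $c$; its size is the number of edges of the star it explores (an edge $\{c,v\}$ is explored by entering from $c$ to $v$ at one of its labels and later exiting from $v$ to $c$ at a strictly larger label). \textsc{MaxStarExp($k$)}: given a temporal star in which every edge has at most $k$ labels, output a (partial) exploration of maximum size. Algorithm GREEDY: maintain a set $\mathcal{C}$ of candidate edges (initially all edges), a set $Exp$ of explored edges (initially empty), and a time $t:=0$. While some edge of $\mathcal{C}$ can still be explored entering at a label $\ge t$ (i.e.\ has two labels $\ge t$): among all edges $e\in\mathcal{C}$ and all ways of exploring $e$ entering at a label $\ge t$ (and exiting at the next label of $e$), choose one with minimum exit time $t_0$; add $e$ to $Exp$ with this exploration window, remove $e$ from $\mathcal{C}$, and set $t:=t_0+1$. Output the exploration formed by the chosen windows in order.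
   Formalization: The lower bound in Θ(kn²) is proved for worst-case instances with k ≥ 2 and n ≥ 2 only: for k = 1 no edge can be explored and the algorithm stops after one linear pass, and for n = 1 there are no edges; the upper bound holds for every k ≥ 1. -}

module Defs where

open import Data.Bool using (Bool; if_then_else_)
open import Data.Fin using (Fin; zero; suc)
open import Data.Fin.Properties using (_≟_)
open import Data.List using (List; []; _∷_; length; map; tabulate; deduplicate)
open import Data.List.Membership.Propositional using (_∈_)
open import Data.List.Relation.Unary.All using (All)
open import Data.List.Relation.Unary.Linked using (Linked)
open import Data.Maybe using (Maybe; just; nothing)
open import Data.Nat using (ℕ; zero; suc; _+_; _*_; _^_; _≤_; _<_; _≤?_)
open import Data.Nat.ListAction using (sum)
open import Data.Nat.Properties using (<-cmp)
open import Data.Product using (_×_; _,_; ∃-syntax)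
open import Data.Unit using (⊤; tt)
open import Data.Vec using (Vec; []; _∷_; allFin)
open import Function using (id; _∘_)
open import Relation.Binary using (Tri; tri<; tri≈; tri>)
open import Relation.Binary.PropositionalEquality using (_≡_)
open import Relation.Nullary using (does)

-- The edge {c,v} of the star is identified with the leaf v.  A finite set
-- of labels is its strictly increasing enumeration.
record TemporalStar : Set where
  field
    leaves   : ℕ
    labels   : Fin leaves → List ℕ
    sorted   : ∀ e → Linked _<_ (labels e)
    positive : ∀ e → All (0 <_) (labels e)

  Edge : Set
  Edge = Fin leaves

  #vertices : ℕ
  #vertices = suc leaves

open TemporalStar public

AtMost_LabelsPerEdge : ℕ → TemporalStar → Set
AtMost k LabelsPerEdge S = ∀ e → length (labels S e) ≤ k

record Window (S : TemporalStar) : Set where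
  constructor window
  field
    edge  : Edge S
    entry : ℕ
    exit  : ℕ

open Window public

module _ (S : TemporalStar) where

  data Vertex : Set where
    centre : Vertex
    leaf   : Edge S → Vertex

  data TimeEdge : Vertex → Vertex → ℕ → Set where
    outward : ∀ {e l} → l ∈ labels S e → TimeEdge centre (leaf e) l
    inward  : ∀ {e l} → l ∈ labels S e → TimeEdge (leaf e) centre l

  -- Journeys from u to v all of whose labels are larger than t.
  data Journey : (u v : Vertex) (t : ℕ) → Set where
    []   : ∀ {u t} → Journey u u t
    step : ∀ {u w v t l} → TimeEdge u w l → t < l → Journey w v l → Journey u v t

  -- Labels are positive, so the bound 0 is no restriction.
  Exploration : Set
  Exploration = Journey centre centre 0

module _ {S : TemporalStar} where

  -- In a star, every move to a leaf is followed by the move back along the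
  -- same edge, so a closed journey at the centre is a sequence of windows.
  windows : ∀ {t} → Journey S centre centre t → List (Window S)
  windows [] = []
  windows (step (outward {e} {l} _) _ (step (inward {l = l′} _) _ J)) =
    window e l l′ ∷ windows J

  -- A journey may visit an edge repeatedly; it is counted once.
  size : Exploration S → ℕ
  size A = length (deduplicate _≟_ (map edge (windows A)))

IsMaximumSize : TemporalStar → ℕ → Set
IsMaximumSize S opt =
  (∃[ A ] size {S} A ≡ opt) × (∀ (A : Exploration S) → size A ≤ opt)

record Timed (A : Set) : Set where
  constructor timed
  field
    time   : ℕ
    result : A

open Timed public

return : ∀ {A} → A → Timed A
return = timed 0

ticks : ℕ → Timed ⊤
ticks n = timed n tt

tick : Timed ⊤
tick = ticks 1

infixl 1 _>>=_ _>>_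

_>>=_ : ∀ {A B} → Timed A → (A → Timed B) → Timed B
m >>= f = timed (time m + time (f (result m))) (result (f (result m)))

_>>_ : ∀ {A B} → Timed A → Timed B → Timed B
m >> n = m >>= λ _ → n

-- An algorithm for MaxStarExp outputs the windows of its exploration, in
-- order.
Algorithm : Set
Algorithm = (S : TemporalStar) → Timed (List (Window S))

-- GREEDY may choose any window of minimum exit time.  Given the instance,
-- the current time t and two windows with the same exit time, the rule says
-- whether the first is preferred.  As t increases from one round to the
-- next, every sequence of choices GREEDY can make is given by some rule.
TieBreaking : Set
TieBreaking = (S : TemporalStar) → ℕ → Window S → Window S → Bool

module Greedy (τ : TieBreaking) (S : TemporalStar) where

  -- The best window met so far, with the position of its edge among the
  -- candidates.
  Best : Set → Set
  Best P = Maybe (P × Window S)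

  improve : ∀ {P} → ℕ → P → Window S → Best P → Timed (Best P)
  improve t p w nothing        = return (just (p , w))
  improve t p w (just (q , v)) = do
    tick
    return (just (better (<-cmp (exit w) (exit v))))
    where
    better : Tri (exit w < exit v) (exit w ≡ exit v) (exit v < exit w) → _
    better (tri< _ _ _) = p , w
    better (tri≈ _ _ _) = if τ S t w v then p , w else q , v
    better (tri> _ _ _) = q , v

  -- All ways of exploring e: enter at a label a ≥ t and exit at the next
  -- label b.
  scanLabels : ∀ {P} → ℕ → P → Edge S → List ℕ → Best P → Timed (Best P)
  scanLabels t p e []           best = do
    tick
    return best
  scanLabels t p e (a ∷ [])     best = do
    tick
    return best
  scanLabels t p e (a ∷ b ∷ ls) best = do
    tick
    best′ ← if does (t ≤? a) then improve t p (window e a b) best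
                             else return best
    scanLabels t p e (b ∷ ls) best′

  scan : ∀ {P c} → ℕ → (Fin c → P) → Vec (Edge S) c → Best P → Timed (Best P)
  scan t pos []      best = do
    tick
    return best
  scan t pos (e ∷ C) best = do
    tick
    best′ ← scanLabels t (pos zero) e (labels S e) best
    scan t (pos ∘ suc) C best′

  remove : ∀ {c} → Vec (Edge S) (suc c) → Fin (suc c) → Timed (Vec (Edge S) c)
  remove (e ∷ C)          zero    = do
    tick
    return C
  remove (e ∷ C@(_ ∷ _)) (suc i) = do
    tick
    C′ ← remove C i
    return (e ∷ C′)

  -- The set of explored edges is not stored: it consists of the edges of the
  -- windows emitted.
  loop : ∀ {c} → ℕ → Vec (Edge S) c → Timed (List (Window S))
  loop {zero}  t C = do
    tick
    return []
  loop {suc c} t C = do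
    tick
    just (i , w) ← scan t id C nothing
      where nothing → return []
    C′ ← remove C i
    ws ← loop (suc (exit w)) C′
    return (w ∷ ws)

  run : Timed (List (Window S))
  run = do
    ticks (leaves S)
    loop 0 (allFin (leaves S))

greedy : TieBreaking → Algorithm
greedy τ S = Greedy.run τ S

Returns : Algorithm → (S : TemporalStar) → Exploration S → Set
Returns 𝒜 S A = windows A ≡ result (𝒜 S)

-- On every instance of MaxStarExp(k), 𝒜 returns an exploration A with
-- |OPT| ≤ ρ |A|.
IsApproximation : (ρ k : ℕ) → Algorithm → Set
IsApproximation ρ k 𝒜 =
  ∀ S → AtMost k LabelsPerEdge S →
  ∃[ A ] Returns 𝒜 S A × (∃[ opt ] IsMaximumSize S opt × opt ≤ ρ * size A)

-- Operations on labels have unit cost, so each label contributes one unit.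
inputSize : TemporalStar → ℕ
inputSize S = #vertices S + sum (tabulate (length ∘ labels S))

PolynomialTime : (k : ℕ) → Algorithm → Set
PolynomialTime k 𝒜 =
  ∃[ a ] ∃[ d ] ∀ S → AtMost k LabelsPerEdge S →
  time (𝒜 S) ≤ a * inputSize S ^ d

-- The worst-case running time over all instances with n vertices and at most
-- k labels per edge, as a function of k and n.  The constants depend on
-- neither.
RunsInO : Algorithm → (ℕ → ℕ → ℕ) → Set
RunsInO 𝒜 g =
  ∃[ a ] ∀ k → 1 ≤ k → ∀ S → AtMost k LabelsPerEdge S →
  time (𝒜 S) ≤ a * g k (#vertices S)

-- The lower bound excludes k = 1, where no edge can be explored at all and a
-- single pass over the n - 1 edges suffices, and n = 1, where there are no
-- edges.
RunsInΩ : Algorithm → (ℕ → ℕ → ℕ) → Set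
RunsInΩ 𝒜 g =
  ∃[ b ] ∀ k n → 2 ≤ k → 2 ≤ n →
  ∃[ S ] #vertices S ≡ n × AtMost k LabelsPerEdge S × g k n ≤ b * time (𝒜 S)

RunsInΘ : Algorithm → (ℕ → ℕ → ℕ) → Set
RunsInΘ 𝒜 g = RunsInO 𝒜 g × RunsInΩ 𝒜 g

{-# OPTIONS --safe #-}

-- Let w be the window chosen by GREEDY at time t, and J an exploration that
-- starts at t or later.  No window of J on a candidate edge exits before w
-- does, and among the windows of J exiting no earlier only the first can enter
-- before w has ended.  Hence each choice costs J at most two candidate edges:
-- the edge of w itself and the edge of that first window.
module Submission where

open import Defs
open import Data.Bool using (if_then_else_; true; false)
open import Data.Empty using (⊥-elim)
open import Data.Fin using (Fin; zero; suc; toℕ)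
import Data.Fin.Properties as Fin
open import Data.List using (List; []; _∷_; _++_; length; map; concat; tabulate; applyUpTo;
                             deduplicate)
open import Data.List.Extrema.Nat using (max; xs≤max)
open import Data.List.Membership.Propositional using (_∈_)
open import Data.List.Membership.Propositional.Properties
  using (∈-∃++; ∈-concat⁺′; ∈-tabulate⁺; ∈-allFin; ∈-applyUpTo⁺; ∈-applyUpTo⁻;
         ∈-deduplicate⁺; ∈-deduplicate⁻)
open import Data.List.Properties using (length-tabulate; length-map; length-applyUpTo)
open import Data.List.Relation.Binary.Permutation.Propositional as ↭ using (_↭_; ↭-sym; ↭⇒↭ₛ)
open import Data.List.Relation.Binary.Permutation.Propositional.Properties
  using (∈-resp-↭; ↭-length; shift)
open import Data.List.Relation.Binary.Permutation.Setoid.Properties using (Unique-resp-↭)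
open import Data.List.Relation.Unary.All as All using (All; []; _∷_)
import Data.List.Relation.Unary.All.Properties as All
open import Data.List.Relation.Unary.AllPairs using ([]; _∷_)
open import Data.List.Relation.Unary.Any using (here; there)
open import Data.List.Relation.Unary.Linked as Linked using (Linked; []; [-]; _∷_)
import Data.List.Relation.Unary.Linked.Properties as Linked
open import Data.List.Relation.Unary.Unique.DecPropositional.Properties using (deduplicate-!)
open import Data.List.Relation.Unary.Unique.Propositional using (Unique)
open import Data.List.Relation.Unary.Unique.Propositional.Properties using (allFin⁺)
open import Data.Maybe using (just; nothing)
open import Data.Maybe.Relation.Unary.All as MAll using (just; nothing)
open import Data.Maybe.Relation.Unary.Any as MAny using (just)
open import Data.Nat
  using (ℕ; zero; suc; _+_; _*_; _^_; _≤_; _<_; _≤?_; _≤ᵇ_; _<?_; z≤n; s≤s; z<s)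
open import Data.Nat.Properties
open import Data.Nat.Tactic.RingSolver using (solve-∀)
open import Data.Product using (Σ; _×_; _,_; ∃; ∃-syntax; proj₁; proj₂)
open import Data.Sum using (inj₁; inj₂; [_,_]′)
open import Data.Vec as Vec using (Vec; []; _∷_; lookup; toList; allFin)
import Data.Vec.Membership.Propositional.Properties as Vec
open import Function using (_∘_; id)
open import Relation.Binary using (tri<; tri≈; tri>)
open import Relation.Binary.PropositionalEquality
  using (_≡_; _≢_; refl; sym; cong; subst; setoid)
open import Relation.Nullary using (¬_; Dec; yes; no; does; ofʸ; ofⁿ)
open import Relation.Nullary.Decidable using (map′; _⊎-dec_)
open import Relation.Unary using (Decidable)

-- Sizes of duplicate-free lists.

length-mono-⊆ : ∀ {A : Set} {xs ys : List A} → Unique xs → (∀ {x} → x ∈ xs → x ∈ ys) →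
                length xs ≤ length ys
length-mono-⊆ {xs = []} _ _ = z≤n
length-mono-⊆ {xs = x ∷ xs} (x∉ ∷ u) ⊆ys with as , bs , refl ← ∈-∃++ (⊆ys (here refl)) =
  subst (suc (length xs) ≤_) (sym (↭-length (shift x as bs))) (s≤s (length-mono-⊆ u ⊆rest))
  where
  ⊆rest : ∀ {y} → y ∈ xs → y ∈ as ++ bs
  ⊆rest y∈ with ∈-resp-↭ (shift x as bs) (⊆ys (there y∈))
  ... | here refl = ⊥-elim (All.lookup x∉ y∈ refl)
  ... | there y∈′ = y∈′

-- Existence of a maximum size.

-- Constructively, a maximum size exists because the journeys, whose labels
-- increase and are bounded, can be searched exhaustively.
Searchable : Set → Set₁
Searchable A = ∀ {P : A → Set} → Decidable P → Dec (∃ P)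

-- The predicate may depend on the membership proof, because a time edge carries one.
search-∈ : ∀ (xs : List ℕ) → Searchable (∃[ x ] x ∈ xs)
search-∈ [] _ = no λ { ((_ , ()) , _) }
search-∈ (x ∷ xs) P? =
  map′ [ (λ p → (x , here refl) , p) , (λ { ((y , y∈) , p) → (y , there y∈) , p }) ]′
       (λ { ((_ , here refl) , p) → inj₁ p ; ((y , there y∈) , p) → inj₂ ((y , y∈) , p) })
       (P? (x , here refl) ⊎-dec search-∈ xs (λ (y , y∈) → P? (y , there y∈)))

-- The bound is lowered until some value reaches it.
maximum : ∀ {A} → Searchable A → A → (f : A → ℕ) → ∀ bound → (∀ a → f a ≤ bound) →
          ∃[ a ] (∀ b → f b ≤ f a)
maximum search a f zero    f≤ = a , λ b → ≤-trans (f≤ b) z≤n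
maximum search a f (suc m) f≤ with search (λ b → suc m ≤? f b)
... | yes (b , m<fb) = b , λ c → ≤-trans (f≤ c) m<fb
... | no  all≤       = maximum search a f m λ b → ≮⇒≥ λ m<fb → all≤ (b , m<fb)

search-< : ∀ m n → Searchable (m < n)
search-< m n {P} P? with m <? n
... | no  m≮n = no λ (m<n , _) → m≮n m<n
... | yes m<n = map′ (m<n ,_) (λ (q , p) → subst P (<-irrelevant q m<n) p) (P? m<n)

module _ (S : TemporalStar) where

  ends-by : ∃[ T ] (∀ e {l} → l ∈ labels S e → l ≤ T)
  ends-by = max 0 all , λ e l∈ → All.lookup (xs≤max 0 all) (∈-concat⁺′ l∈ (∈-tabulate⁺ e))
    where all = concat (tabulate (labels S))

  search-timeEdge : ∀ u → Searchable (∃[ w ] ∃[ l ] TimeEdge S u w l)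
  search-timeEdge centre P? =
    map′ (λ { (e , (l , l∈) , p) → (leaf e , l , outward l∈) , p })
         (λ { ((leaf e , l , outward l∈) , p) → e , (l , l∈) , p })
         (Fin.any? λ e → search-∈ (labels S e) λ (l , l∈) → P? (leaf e , l , outward l∈))
  search-timeEdge (leaf e) P? =
    map′ (λ { ((l , l∈) , p) → (centre , l , inward l∈) , p })
         (λ { ((centre , l , inward l∈) , p) → (l , l∈) , p })
         (search-∈ (labels S e) λ (l , l∈) → P? (centre , l , inward l∈))

  label≤ : ∀ {u w l} → TimeEdge S u w l → l ≤ proj₁ ends-by
  label≤ (outward l∈) = proj₂ ends-by _ l∈
  label≤ (inward l∈)  = proj₂ ends-by _ l∈

  -- Journeys with at least one time edge, as a nested sum whose components can be searched in turn.
  Step : ∀ {u t} → (Journey S u centre t → Set) → Set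
  Step {u} {t} P =
    ∃ λ ((w , l , te) : ∃[ w ] ∃[ l ] TimeEdge S u w l) →
    Σ (t < l) λ t<l → ∃ λ (J : Journey S w centre l) → P (step te t<l J)

  mutual
    -- Every step raises the time by at least one, so `fuel` bounds the number of steps possible up
    -- to the last label.
    search-journey : ∀ fuel {t} → proj₁ ends-by ≤ t + fuel →
                     ∀ u → Searchable (Journey S u centre t)
    search-journey fuel T≤ centre {P} P? =
      map′ [ (λ p → [] , p) , (λ { (_ , t<l , J , p) → step _ t<l J , p }) ]′
           (λ { ([] , p) → inj₁ p ; (step te t<l J , p) → inj₂ (_ , t<l , J , p) })
           (P? [] ⊎-dec search-step fuel T≤ P?)
    search-journey fuel T≤ (leaf e) P? =
      map′ (λ { (_ , t<l , J , p) → step _ t<l J , p })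
           (λ { (step te t<l J , p) → _ , t<l , J , p })
           (search-step fuel T≤ P?)

    search-step : ∀ fuel {t u} → proj₁ ends-by ≤ t + fuel →
                  {P : Journey S u centre t → Set} → Decidable P → Dec (Step P)
    -- Here every label is at most `t`, so no time edge is available any more.
    search-step zero {t} T≤ P? =
      no λ ((_ , _ , te) , t<l , _) →
        <⇒≱ t<l (≤-trans (label≤ te) (subst (_ ≤_) (+-identityʳ t) T≤))
    search-step (suc f) {t} T≤ P? =
      search-timeEdge _ λ (w , l , te) → search-< t l λ t<l →
      search-journey f (≤-trans T≤ (subst (_≤ l + f) (sym (+-suc t f)) (+-monoˡ-≤ f t<l))) w
        λ J → P? (step te t<l J)

  size≤leaves : (A : Exploration S) → size A ≤ leaves S
  size≤leaves A = subst (size A ≤_) (length-tabulate {n = leaves S} id)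
    (length-mono-⊆ (deduplicate-! Fin._≟_ (map edge (windows A))) (λ {e} _ → ∈-allFin e))

  maximumSize : ∃[ opt ] IsMaximumSize S opt
  maximumSize with A , max ← maximum (search-journey (proj₁ ends-by) ≤-refl centre) [] size
                               (leaves S) size≤leaves
    = size A , (A , refl) , max

  -- Runs of GREEDY and the factor two.

  -- The exit need not be the next label of the edge, so that every window of an arbitrary
  -- exploration entering at `t` or later fits.
  record Fits (t : ℕ) (w : Window S) : Set where
    constructor fits
    field
      entry∈     : entry w ∈ labels S (edge w)
      exit∈      : exit w ∈ labels S (edge w)
      starts     : t ≤ entry w
      entry<exit : entry w < exit w

  -- Run t es ws: from time t with candidates es, GREEDY can choose ws.
  data Run : ℕ → List (Edge S) → List (Window S) → Set where
    stop : ∀ {t es} → (∀ {w} → edge w ∈ es → ¬ Fits t w) → Run t es []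
    pick : ∀ {t es es′ w ws} → Fits t w →
           (∀ {v} → edge v ∈ es → Fits t v → exit w ≤ exit v) →
           es ↭ edge w ∷ es′ → Run (suc (exit w)) es′ ws → Run t es (w ∷ ws)

module _ {S : TemporalStar} where

  -- Journeys bound labels strictly, runs weakly, and the second hypothesis bridges the two.
  -- Positivity of the labels supplies it at time 0; after a window it is immediate, the time being
  -- one past the exit.
  journey : ∀ {t₀ t es ws} → Run S t es ws →
            (∀ {e l} → l ∈ labels S e → t ≤ l → t₀ < l) →
            Σ (Journey S centre centre t₀) λ J → windows J ≡ ws
  journey (stop _) _ = [] , refl
  journey (pick (fits a∈ b∈ t≤a a<b) _ _ run) later with J , eq ← journey run (λ _ → id)
    = step (outward a∈) (later a∈ t≤a) (step (inward b∈) a<b J) , cong (_ ∷_) eq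

  picked⊆ : ∀ {t es ws} → Run S t es ws → ∀ {e} → e ∈ map edge ws → e ∈ es
  picked⊆ (pick _ _ es↭ _)   (here refl) = ∈-resp-↭ (↭-sym es↭) (here refl)
  picked⊆ (pick _ _ es↭ run) (there e∈)  = ∈-resp-↭ (↭-sym es↭) (there (picked⊆ run e∈))

  -- A chosen edge leaves the candidates and is never chosen again, so each window will count in
  -- `size`.
  picked-unique : ∀ {t es ws} → Unique es → Run S t es ws → Unique (map edge ws)
  picked-unique u (stop _) = []
  picked-unique u (pick _ _ es↭ run) with w∉ ∷ u′ ← Unique-resp-↭ (setoid _) (↭⇒↭ₛ es↭) u
    = All.tabulate (λ e∈ → All.lookup w∉ (picked⊆ run e∈)) ∷ picked-unique u′ run

  -- Induction on `J`. Its labels exceed `s`, so `t ≤ suc s` makes all its windows enter at `t` or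
  -- later. `E` collects the edges charged, two per choice.
  cover : ∀ {t es ws s} → Run S t es ws → (J : Journey S centre centre s) → t ≤ suc s →
          ∃[ E ] length E ≤ 2 * length ws ×
                 (∀ {e} → e ∈ es → e ∈ map edge (windows J) → e ∈ E)
  cover run [] _ = [] , z≤n , λ _ ()
  cover run@(stop none) (step (outward a∈) s<a (step (inward b∈) a<b J)) t≤
    with E , short , covers ← cover run J (≤-trans t≤ (≤-trans s<a (<⇒≤ (m<n⇒m<1+n a<b))))
    = E , short , λ { e∈ (here refl) → ⊥-elim (none e∈ (fits a∈ b∈ (≤-trans t≤ s<a) a<b))
                    ; e∈ (there ∈J)  → covers e∈ ∈J }
  cover {ws = w ∷ ws} run@(pick _ least es↭ rest)
        (step (outward {e} {a} a∈) s<a (step (inward {l = b} b∈) a<b J)) t≤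
    with exit w ≤? b
  -- This window exits before `w`, so its edge is not a candidate and nothing is charged.
  ... | no  w≰b
    with E , short , covers ← cover run J (≤-trans t≤ (≤-trans s<a (<⇒≤ (m<n⇒m<1+n a<b))))
    = E , short , λ { e∈ (here refl) → ⊥-elim (w≰b (least e∈ (fits a∈ b∈ (≤-trans t≤ s<a) a<b)))
                    ; e∈ (there ∈J)  → covers e∈ ∈J }
  -- Later windows of `J` enter after `b`, hence after `w` has ended, and are left to `rest`.
  -- `edge w` is charged too: `J` may still explore it, but it is no candidate of `rest`.
  ... | yes w≤b
    with E , short , covers ← cover rest J (s≤s w≤b)
    = e ∷ edge w ∷ E , subst (2 + length E ≤_) (sym (*-suc 2 (length ws))) (s≤s (s≤s short)) ,
      λ { _  (here refl) → here refl
        ; e∈ (there ∈J)  → there (covers-rest covers (∈-resp-↭ es↭ e∈) ∈J) }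
    where
    covers-rest : ∀ {es′ E} → (∀ {e} → e ∈ es′ → e ∈ map edge (windows J) → e ∈ E) →
                  ∀ {x} → x ∈ edge w ∷ es′ → x ∈ map edge (windows J) → x ∈ edge w ∷ E
    covers-rest c (here refl) _  = here refl
    covers-rest c (there x∈)  ∈J = there (c x∈ ∈J)

  -- As all edges are candidates at the start, `E` contains every edge that the optimum `O`
  -- explores; as the chosen edges are distinct, `length ws` is at most `size A`.
  run⇒2-approximate : ∀ {es ws} → Unique es → (∀ e → e ∈ es) → Run S 0 es ws →
    ∃[ A ] windows A ≡ ws × (∃[ opt ] IsMaximumSize S opt × opt ≤ 2 * size A)
  run⇒2-approximate {ws = ws} u all∈ run
    with A , refl ← journey run (λ {e} l∈ _ → All.lookup (positive S e) l∈)
       | opt , (O , refl) , max ← maximumSize S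
    with E , short , covers ← cover run O z≤n
    = A , refl , opt , ((O , refl) , max) , (begin
        size O         ≤⟨ length-mono-⊆ (deduplicate-! Fin._≟_ (map edge (windows O)))
                            (λ {e} e∈ → covers (all∈ e) (∈-deduplicate⁻ Fin._≟_ _ e∈)) ⟩
        length E       ≤⟨ short ⟩
        2 * length ws  ≤⟨ *-monoʳ-≤ 2 ws≤ ⟩
        2 * size A     ∎)
    where
    open ≤-Reasoning
    ws≤ : length ws ≤ length (deduplicate Fin._≟_ (map edge ws))
    ws≤ = subst (_≤ length (deduplicate Fin._≟_ (map edge ws))) (length-map edge ws)
            (length-mono-⊆ (picked-unique u run) (∈-deduplicate⁺ Fin._≟_))

-- The implementation produces a run.

module _ (τ : TieBreaking) (S : TemporalStar) where
  open Greedy τ S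

  module _ {P : Set} where

    -- `MAny.Any` is empty at `nothing`, so this also asserts that a window has been found.
    Within : ℕ → Best P → Set
    Within m = MAny.Any λ (_ , w) → exit w ≤ m

    within-≤ : ∀ {m n best} → m ≤ n → Within m best → Within n best
    within-≤ m≤n = MAny.map λ w≤m → ≤-trans w≤m m≤n

    improve-least : ∀ t p w best → Within (exit w) (result (improve t p w best))
    improve-least t p w nothing = just ≤-refl
    improve-least t p w (just (q , v)) with <-cmp (exit w) (exit v)
    ... | tri< _ _ _ = just ≤-refl
    ... | tri> _ _ v<w = just (<⇒≤ v<w)
    ... | tri≈ _ w≡v _ with τ S t w v
    ...   | true  = just ≤-refl
    ...   | false = just (≤-reflexive (sym w≡v))

    improve-within : ∀ t p w {m best} → Within m best → Within m (result (improve t p w best))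
    improve-within t p w {best = just (q , v)} (just v≤m) with <-cmp (exit w) (exit v)
    ... | tri< w<v _ _ = just (≤-trans (<⇒≤ w<v) v≤m)
    ... | tri> _ _ _ = just v≤m
    ... | tri≈ _ w≡v _ with τ S t w v
    ...   | true  = just (≤-trans (≤-reflexive w≡v) v≤m)
    ...   | false = just v≤m

    improve-sound : ∀ {Q : P × Window S → Set} t p w {best} → Q (p , w) → MAll.All Q best →
                    MAll.All Q (result (improve t p w best))
    improve-sound t p w nq nothing = just nq
    improve-sound t p w {just (q , v)} nq (just oq) with <-cmp (exit w) (exit v)
    ... | tri< _ _ _ = just nq
    ... | tri> _ _ _ = just oq
    ... | tri≈ _ _ _ with τ S t w v
    ...   | true  = just nq
    ...   | false = just oq

    -- The conditional inside `scanLabels`, named for reference; the two agree by computation.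
    consider : ℕ → P → Window S → Best P → Timed (Best P)
    consider t p w best = if does (t ≤? entry w) then improve t p w best else return best

    consider-least : ∀ t p w best → t ≤ entry w → Within (exit w) (result (consider t p w best))
    -- `does (t ≤? entry w)` computes to this boolean; the reflection recovers its meaning.
    consider-least t p w best t≤ with t ≤ᵇ entry w | ≤ᵇ-reflects-≤ t (entry w)
    ... | true  | _        = improve-least t p w best
    ... | false | ofⁿ t≰ = ⊥-elim (t≰ t≤)

    consider-within : ∀ t p w {m best} → Within m best →
                      Within m (result (consider t p w best))
    consider-within t p w wi with t ≤ᵇ entry w
    ... | true  = improve-within t p w wi
    ... | false = wi

    consider-sound : ∀ {Q : P × Window S → Set} t p w {best} → (t ≤ entry w → Q (p , w)) → MAll.All Q best →
                     MAll.All Q (result (consider t p w best))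
    consider-sound t p w q qs with t ≤ᵇ entry w | ≤ᵇ-reflects-≤ t (entry w)
    ... | true  | ofʸ t≤ = improve-sound t p w (q t≤) qs
    ... | false | _      = qs

    scanLabels-within : ∀ t p e ls {m best} → Within m best →
                        Within m (result (scanLabels t p e ls best))
    scanLabels-within t p e []           wi = wi
    scanLabels-within t p e (_ ∷ [])     wi = wi
    scanLabels-within t p e (a ∷ b ∷ ls) wi =
      scanLabels-within t p e (b ∷ ls) (consider-within t p (window e a b) wi)

    -- The label following `a` is at most `b`, so the window from `a` to it exits by `b`: trying
    -- only next labels as exits loses nothing.
    scanLabels-least : ∀ t p e ls best → Linked _<_ ls → ∀ {a b} → a ∈ ls → b ∈ ls →
                       t ≤ a → a < b → Within b (result (scanLabels t p e ls best))
    scanLabels-least t p e (x ∷ [])     best _ (here refl) (here refl) _ a<b =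
      ⊥-elim (<-irrefl refl a<b)
    scanLabels-least t p e (x ∷ y ∷ ls) best (x<y ∷ s) {b = b} a∈ b∈ t≤a a<b =
      cases a∈ b∈
      where
      best′ = result (consider t p (window e x y) best)
      cases : _ → _ → Within b (result (scanLabels t p e (y ∷ ls) best′))
      cases (here refl) (here refl) = ⊥-elim (<-irrefl refl a<b)
      cases (here refl) (there b∈) = scanLabels-within t p e (y ∷ ls)
        (within-≤ (All.lookup (Linked.Linked⇒All ≤-trans ≤-refl (Linked.map <⇒≤ s)) b∈)
          (consider-least t p (window e x y) best t≤a))
      cases (there a∈) (here refl) =
        ⊥-elim (<-asym a<b (All.lookup (Linked.Linked⇒All <-trans x<y s) a∈))
      cases (there a∈) (there b∈) = scanLabels-least t p e (y ∷ ls) best′ s a∈ b∈ t≤a a<b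

    scanLabels-sound : ∀ {Q : P × Window S → Set} t p e ls {best} →
                       (∀ {a b} → Fits S t (window e a b) → Q (p , window e a b)) →
                       (∀ {l} → l ∈ ls → l ∈ labels S e) → Linked _<_ ls → MAll.All Q best →
                       MAll.All Q (result (scanLabels t p e ls best))
    scanLabels-sound t p e []           q ⊆e s qs = qs
    scanLabels-sound t p e (_ ∷ [])     q ⊆e s qs = qs
    scanLabels-sound t p e (a ∷ b ∷ ls) q ⊆e (a<b ∷ s) qs =
      scanLabels-sound t p e (b ∷ ls) q (⊆e ∘ there) s
        (consider-sound t p (window e a b)
          (λ t≤a → q (fits (⊆e (here refl)) (⊆e (there (here refl))) t≤a a<b)) qs)

    scan-within : ∀ {c} t pos (C : Vec (Edge S) c) {m best} → Within m best →
                  Within m (result (scan t pos C best))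
    scan-within t pos []      wi = wi
    scan-within t pos (e ∷ C) wi =
      scan-within t (pos ∘ suc) C (scanLabels-within t (pos zero) e (labels S e) wi)

    scan-least : ∀ {c} t pos (C : Vec (Edge S) c) best {v} → edge v ∈ toList C → Fits S t v →
                 Within (exit v) (result (scan t pos C best))
    scan-least t pos (e ∷ C) best (here refl) (fits a∈ b∈ t≤a a<b) =
      scan-within t (pos ∘ suc) C
        (scanLabels-least t (pos zero) e (labels S e) best (sorted S e) a∈ b∈ t≤a a<b)
    scan-least t pos (e ∷ C) best (there v∈) f = scan-least t (pos ∘ suc) C _ v∈ f

    -- `Q` sees the position as well, because `loop` removes the chosen edge by position.
    scan-sound : ∀ {Q : P × Window S → Set} {c} t pos (C : Vec (Edge S) c) {best} →
                 (∀ i {w} → edge w ≡ lookup C i → Fits S t w → Q (pos i , w)) →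
                 MAll.All Q best → MAll.All Q (result (scan t pos C best))
    scan-sound t pos []      q qs = qs
    scan-sound t pos (e ∷ C) q qs =
      scan-sound t (pos ∘ suc) C (q ∘ suc)
        (scanLabels-sound t (pos zero) e (labels S e) (q zero refl) id (sorted S e) qs)

  remove-↭ : ∀ {c} (C : Vec (Edge S) (suc c)) i →
             toList C ↭ lookup C i ∷ toList (result (remove C i))
  remove-↭ (e ∷ C)         zero    = ↭.refl
  remove-↭ (e ∷ C@(_ ∷ _)) (suc i) = ↭.trans (↭.prep e (remove-↭ C i)) (↭.swap e _ ↭.refl)

  -- Indexed by the result of the scan, so that matching fixes the branch of `loop` and yields the
  -- premises of `stop` or `pick`.
  data Choice {c} (t : ℕ) (C : Vec (Edge S) c) : Best (Fin c) → Set where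
    none   : (∀ {w} → edge w ∈ toList C → ¬ Fits S t w) → Choice t C nothing
    chosen : ∀ {i w} → edge w ≡ lookup C i → Fits S t w →
             (∀ {v} → edge v ∈ toList C → Fits S t v → exit w ≤ exit v) →
             Choice t C (just (i , w))

  choice : ∀ {c} t (C : Vec (Edge S) c) → Choice t C (result (scan t id C nothing))
  choice t C
    with result (scan t id C nothing)
       | scan-sound {Q = λ (i , w) → edge w ≡ lookup C i × Fits S t w} t id C (λ _ → _,_) nothing
       | (λ {v} → scan-least t id C nothing {v})
  ... | nothing | _ | least = none λ w∈ f → case-nothing (least w∈ f)
    where
    case-nothing : ∀ {m} → ¬ Within {Fin _} m nothing
    case-nothing ()
  ... | just _  | just (w≡ , f) | least = chosen w≡ f λ v∈ g → MAny.drop-just (least v∈ g)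

  loop-run : ∀ {c} t (C : Vec (Edge S) c) → Run S t (toList C) (result (loop t C))
  loop-run {zero}  t [] = stop λ ()
  loop-run {suc c} t C with result (scan t id C nothing) | choice t C
  ... | nothing      | none empty      = stop empty
  ... | just (i , w) | chosen refl f least =
    pick f least (remove-↭ C i) (loop-run (suc (exit w)) (result (remove C i)))

-- Upper bound on the running time.

-- Naming the gap `d` as a polynomial leaves an equation for the ring solver.
≤-by-slack : ∀ {m n} d → n ≡ m + d → m ≤ n
≤-by-slack d refl = m≤m+n _ d

toList-tabulate : ∀ {A : Set} {n} (f : Fin n → A) → toList (Vec.tabulate f) ≡ tabulate f
toList-tabulate {n = zero}  f = refl
toList-tabulate {n = suc n} f = cong (f zero ∷_) (toList-tabulate (f ∘ suc))

allFin-unique : ∀ n → Unique (toList (allFin n))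
allFin-unique n = subst Unique (sym (toList-tabulate id)) (allFin⁺ n)

module _ (τ : TieBreaking) (S : TemporalStar) where
  open Greedy τ S

  module _ {P : Set} where

    consider-time : ∀ t p w (best : Best P) → time (consider τ S t p w best) ≤ 1
    consider-time t p w best with t ≤ᵇ entry w | best
    ... | true  | nothing = z≤n
    ... | true  | just _  = s≤s z≤n
    ... | false | _       = z≤n

    scanLabels-time≤ : ∀ t (p : P) e ls best →
                       time (scanLabels t p e ls best) ≤ 1 + length ls * 2
    scanLabels-time≤ t p e []           best = ≤-refl
    scanLabels-time≤ t p e (_ ∷ [])     best = s≤s z≤n
    scanLabels-time≤ t p e (a ∷ b ∷ ls) best =
      s≤s (+-mono-≤ (consider-time t p (window e a b) best) (scanLabels-time≤ t p e (b ∷ ls) _))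

    scanLabels-time≥ : ∀ t (p : P) e ls best → length ls ≤ time (scanLabels t p e ls best)
    scanLabels-time≥ t p e []           best = z≤n
    scanLabels-time≥ t p e (_ ∷ [])     best = ≤-refl
    scanLabels-time≥ t p e (a ∷ b ∷ ls) best =
      s≤s (≤-trans (scanLabels-time≥ t p e (b ∷ ls) _) (m≤n+m _ _))

    -- An edge costs one tick itself, one for the end of its labels, and at most two per label: the
    -- visit and a comparison.
    scan-time≤ : ∀ {k} → AtMost k LabelsPerEdge S → ∀ {c} t pos (C : Vec (Edge S) c) best →
                 time (scan {P} t pos C best) ≤ 1 + c * (2 + k * 2)
    scan-time≤ ≤k t pos []      best = ≤-refl
    scan-time≤ {k} ≤k {suc c} t pos (e ∷ C) best = begin
      1 + (time (scanLabels t (pos zero) e (labels S e) best) + _)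
        ≤⟨ s≤s (+-mono-≤ (≤-trans (scanLabels-time≤ t (pos zero) e (labels S e) best)
                                  (s≤s (*-monoˡ-≤ 2 (≤k e))))
                         (scan-time≤ ≤k t (pos ∘ suc) C _)) ⟩
      1 + (1 + k * 2 + (1 + c * (2 + k * 2)))
        ≡⟨ regroup k (c * (2 + k * 2)) ⟩
      1 + (2 + k * 2 + c * (2 + k * 2)) ∎
      where
      open ≤-Reasoning
      regroup : ∀ k d → 1 + (1 + k * 2 + (1 + d)) ≡ 1 + (2 + k * 2 + d)
      regroup = solve-∀

    scan-time≥ : ∀ {k} → (∀ e → k ≤ length (labels S e)) → ∀ {c} t pos (C : Vec (Edge S) c) best →
                 c * k ≤ time (scan {P} t pos C best)
    scan-time≥ k≤ t pos []      best = z≤n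
    scan-time≥ k≤ t pos (e ∷ C) best = ≤-trans
      (+-mono-≤ (≤-trans (k≤ e) (scanLabels-time≥ t (pos zero) e (labels S e) best))
                (scan-time≥ k≤ t (pos ∘ suc) C _))
      (n≤1+n _)

  remove-time : ∀ {c} (C : Vec (Edge S) (suc c)) i → time (remove C i) ≤ suc c
  remove-time (e ∷ C)           zero    = s≤s z≤n
  remove-time (e ∷ C@(_ ∷ _)) (suc i) =
    s≤s (≤-trans (≤-reflexive (+-identityʳ _)) (remove-time C i))

  -- `N` stays fixed while `c` shrinks. A round costs one tick, a scan of at most
  -- `1 + N * (2 + k * 2)` and a removal of at most `N`.
  loop-time≤ : ∀ {k N} → AtMost k LabelsPerEdge S → ∀ {c} t (C : Vec (Edge S) c) → c ≤ N →
               time (loop t C) ≤ 1 + c * (2 + N * (3 + k * 2))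
  loop-time≤ ≤k {zero} t C c≤N = ≤-refl
  loop-time≤ {k} {N} ≤k {suc c} t C c≤N
    with result (scan t id C nothing) | scan-time≤ ≤k t id C nothing
  ... | nothing      | scan≤ = s≤s (begin
    scanTime + 0                          ≡⟨ +-identityʳ scanTime ⟩
    scanTime                              ≤⟨ scan≤ ⟩
    1 + suc c * (2 + k * 2)               ≤⟨ s≤s (*-mono-≤ c≤N (n≤1+n _)) ⟩
    1 + N * (3 + k * 2)                   ≤⟨ n≤1+n _ ⟩
    2 + N * (3 + k * 2)                   ≤⟨ m≤m+n _ _ ⟩
    suc c * (2 + N * (3 + k * 2))         ∎)
    where
    open ≤-Reasoning
    scanTime = time (scan t id C nothing)
  ... | just (i , w) | scan≤ = s≤s (begin
    scanTime + (time (remove C i) + (loopTime + 0))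
      ≤⟨ +-mono-≤ (≤-trans scan≤ (s≤s (*-monoˡ-≤ (2 + k * 2) c≤N)))
           (+-mono-≤ (≤-trans (remove-time C i) c≤N)
             (+-monoˡ-≤ 0 (loop-time≤ ≤k (suc (exit w)) (result (remove C i)) (<⇒≤ c≤N)))) ⟩
    1 + N * (2 + k * 2) + (N + (1 + c * (2 + N * (3 + k * 2)) + 0))
      ≡⟨ regroup N k (c * (2 + N * (3 + k * 2))) ⟩
    2 + N * (3 + k * 2) + c * (2 + N * (3 + k * 2)) ∎)
    where
    open ≤-Reasoning
    scanTime = time (scan t id C nothing)
    loopTime = time (loop (suc (exit w)) (result (remove C i)))
    regroup : ∀ N k d → 1 + N * (2 + k * 2) + (N + (1 + d + 0)) ≡ 2 + N * (3 + k * 2) + d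
    regroup = solve-∀

  greedy-time≤ : ∀ k → 1 ≤ k → AtMost k LabelsPerEdge S →
                 time (greedy τ S) ≤ 5 * (k * #vertices S ^ 2)
  greedy-time≤ k@(suc j) _ ≤k = begin
    N + time (loop 0 (allFin N))            ≤⟨ +-monoʳ-≤ N (loop-time≤ ≤k 0 (allFin N) ≤-refl) ⟩
    -- The constant 5 comes from the leading coefficient: `3 + k * 2` is at most `5 * k`, with
    -- equality at `k = 1`.
    N + (1 + N * (2 + N * (3 + k * 2)))     ≤⟨ ≤-by-slack _ (slack j N) ⟩
    5 * (k * suc N ^ 2)                     ∎
    where
    open ≤-Reasoning
    N = leaves S
    slack : ∀ j N → 5 * (suc j * (suc N * (suc N * 1))) ≡
            N + (1 + N * (2 + N * (3 + suc j * 2))) +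
            (4 + 7 * N + 5 * j + 10 * (j * N) + 3 * (j * (N * N)))
    slack = solve-∀

-- Lower bound on the running time.

-- Consecutive labels, shifted by two from edge to edge: when `k` is at least 2, the windows formed
-- by the first two labels of the edges are disjoint and ordered.
staircase : ∀ k N → TemporalStar
staircase k N = record
  { leaves   = N
  ; labels   = λ e → applyUpTo (suc (2 * toℕ e) +_) k
  ; sorted   = λ e → Linked.applyUpTo⁺₂ _ k λ i → +-monoʳ-< (suc (2 * toℕ e)) (n<1+n i)
  ; positive = λ e → All.applyUpTo⁺₂ _ k λ _ → z<s
  }

staircase-length : ∀ k N e → length (labels (staircase k N) e) ≡ k
staircase-length k N e = length-applyUpTo (suc (2 * toℕ e) +_) k

module _ (τ : TieBreaking) (j N : ℕ) where
  private
    k = 2 + j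
    S = staircase k N

  open Greedy τ S

  firstWindow : Edge S → Window S
  firstWindow e = window e (1 + 2 * toℕ e) (2 + 2 * toℕ e)

  firstWindow-fits : ∀ {t e} → t ≤ 1 + 2 * toℕ e → Fits S t (firstWindow e)
  firstWindow-fits {e = e} t≤ = fits
    (subst (_∈ labels S e) (+-identityʳ _) (∈-applyUpTo⁺ f {0} (s≤s z≤n)))
    (subst (_∈ labels S e) (+-comm _ 1) (∈-applyUpTo⁺ f {1} (s≤s (s≤s z≤n))))
    t≤ ≤-refl
    where f = suc (2 * toℕ e) +_

  firstWindow-earliest : ∀ {t w} → Fits S t w → 2 + 2 * toℕ (edge w) ≤ exit w
  firstWindow-earliest {w = window e _ _} (fits a∈ _ _ a<b)
    with i , _ , refl ← ∈-applyUpTo⁻ (suc (2 * toℕ e) +_) a∈ =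
    ≤-trans (s≤s (m≤m+n _ i)) a<b

  -- The window chosen is the first window of the least candidate, hence it
  -- ends before the first windows of the other candidates and every round
  -- leaves all of them explorable.
  staircase-time : ∀ {c} t (C : Vec (Edge S) c) → Unique (toList C) →
                   (∀ {e} → e ∈ toList C → t ≤ 1 + 2 * toℕ e) →
                   k * (c * suc c) ≤ 2 * time (loop t C)
  staircase-time {zero}  t C u t≤ = ≤-trans (≤-reflexive (*-zeroʳ k)) z≤n
  staircase-time {suc c} t C@(e ∷ _) u t≤
    with result (scan t id C nothing)
       | choice τ S t C
       | scan-time≥ τ S (λ e → ≤-reflexive (sym (staircase-length k N e))) t id C nothing
  -- The first window of the head candidate still fits, so the scan cannot fail.
  ... | nothing | none empty | _ = ⊥-elim (empty (here refl) (firstWindow-fits (t≤ (here refl))))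
  ... | just (i , w) | chosen refl f least | scan≥ = begin
    -- Doubled triangular sum: the round scans `suc c` edges with `k` labels each, and the induction
    -- hypothesis bounds the remaining rounds.
    k * (suc c * suc (suc c))                   ≡⟨ regroup k c ⟩
    2 * (suc c * k) + k * (c * suc c)           ≤⟨ +-mono-≤ (*-monoʳ-≤ 2 scan≥)
                                                     (staircase-time (suc (exit w)) C′ u′ later) ⟩
    2 * scanTime + 2 * loopTime                 ≤⟨ ≤-by-slack _ (slack scanTime (time (remove C i)) loopTime) ⟩
    2 * (1 + (scanTime + (time (remove C i) + (loopTime + 0)))) ∎
    where
    open ≤-Reasoning
    C′ = result (remove C i)
    scanTime = time (scan t id C nothing)
    loopTime = time (loop (suc (exit w)) C′)
    C↭ = remove-↭ τ S C i
    wu′ = Unique-resp-↭ (setoid _) (↭⇒↭ₛ C↭) u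
    u′ : Unique (toList C′)
    u′ with _ ∷ u′ ← wu′ = u′
    w∉ : All (edge w ≢_) (toList C′)
    w∉ with w∉ ∷ _ ← wu′ = w∉
    w∈ : edge w ∈ toList C
    w∈ = ∈-resp-↭ (↭-sym C↭) (here refl)
    later : ∀ {e} → e ∈ toList C′ → suc (exit w) ≤ 1 + 2 * toℕ e
    -- `w` exits no later than the first window of its own edge, hence by `2 * toℕ e`.
    later {e} e∈ = s≤s (≤-trans (least w∈ (firstWindow-fits (t≤ w∈)))
      (≤-trans (≤-reflexive (sym (*-suc 2 _))) (*-monoʳ-≤ 2 w<e)))
      where
      e∈C : e ∈ toList C
      e∈C = ∈-resp-↭ (↭-sym C↭) (there e∈)
      w≤e : toℕ (edge w) ≤ toℕ e
      w≤e = *-cancelˡ-≤ 2 (+-cancelˡ-≤ 2 _ _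
        (≤-trans (firstWindow-earliest f) (least e∈C (firstWindow-fits (t≤ e∈C)))))
      w<e : toℕ (edge w) < toℕ e
      w<e = ≤∧≢⇒< w≤e (All.lookup w∉ e∈ ∘ Fin.toℕ-injective)
    regroup : ∀ k c → k * (suc c * suc (suc c)) ≡ 2 * (suc c * k) + k * (c * suc c)
    regroup = solve-∀
    slack : ∀ s r l → 2 * (1 + (s + (r + (l + 0)))) ≡ 2 * s + 2 * l + (2 + 2 * r)
    slack = solve-∀

greedy-Ω : ∀ τ → RunsInΩ (greedy τ) (λ k n → k * n ^ 2)
-- One factor 2 comes from `staircase-time`, the other from `n ^ 2 ≤ 2 * ((n - 1) * n)` for `2 ≤ n`.
greedy-Ω τ = 4 , λ { (suc (suc j)) (suc (suc m)) (s≤s (s≤s _)) (s≤s (s≤s _)) → instance′ j m }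
  where
  slack : ∀ k m → 2 * (k * (suc m * suc (suc m))) ≡
          k * (suc (suc m) * (suc (suc m) * 1)) + k * (m * m + 2 * m)
  slack = solve-∀

  instance′ : ∀ j m → let k = 2 + j; n = 2 + m in
    ∃[ S ] #vertices S ≡ n × AtMost k LabelsPerEdge S × k * n ^ 2 ≤ 4 * time (greedy τ S)
  instance′ j m = S , refl , (λ e → ≤-reflexive (staircase-length k N e)) , (begin
    k * suc N ^ 2                ≤⟨ ≤-by-slack _ (slack k m) ⟩
    2 * (k * (N * suc N))        ≤⟨ *-monoʳ-≤ 2 (staircase-time τ j N 0 (allFin N) (allFin-unique N)
                                                   (λ _ → z≤n)) ⟩
    2 * (2 * loopTime)           ≡⟨ *-assoc 2 2 loopTime ⟨
    4 * loopTime                 ≤⟨ *-monoʳ-≤ 4 (m≤n+m loopTime N) ⟩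
    4 * time (greedy τ S)        ∎)
    where
    open ≤-Reasoning
    k = 2 + j
    N = suc m
    S = staircase k N
    loopTime = time (Greedy.loop τ S 0 (allFin N))

-- Tightness of the ratio.

-- GREEDY explores edge 0 in (1,2), which overlaps the only window (2,3) of
-- edge 1; the optimum explores edge 1 in (2,3) and then edge 0 in (4,5).
blocking : TemporalStar
blocking = record
  { leaves   = 2
  ; labels   = λ { zero → 1 ∷ 2 ∷ 4 ∷ 5 ∷ [] ; (suc zero) → 2 ∷ 3 ∷ [] }
  ; sorted   = λ { zero       → ≤-refl ∷ n≤1+n 3 ∷ ≤-refl ∷ [-]
                 ; (suc zero) → ≤-refl ∷ [-] }
  ; positive = λ { zero       → z<s ∷ z<s ∷ z<s ∷ z<s ∷ []
                 ; (suc zero) → z<s ∷ z<s ∷ [] }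
  }

greedyOnBlocking : Exploration blocking
greedyOnBlocking =
  step (outward {e = zero} (here refl)) z<s (step (inward (there (here refl))) ≤-refl [])

optimalOnBlocking : Exploration blocking
optimalOnBlocking =
  step (outward {e = suc zero} (here refl)) z<s (step (inward (there (here refl))) ≤-refl
  (step (outward {e = zero} (there (there (here refl)))) ≤-refl
  (step (inward (there (there (there (here refl))))) ≤-refl [])))

theorem6 : (∀ (τ : TieBreaking) →
    (∀ k → 1 ≤ k → IsApproximation 2 k (greedy τ) × PolynomialTime k (greedy τ))
    × RunsInΘ (greedy τ) (λ k n → k * n ^ 2))
    × (∃[ S ] IsMaximumSize S 2
    × (∀ (τ : TieBreaking) → ∃[ A ] Returns (greedy τ) S A × size A ≡ 1))
theorem6 =
  (λ τ → (λ k 1≤k →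
      (λ S _ → run⇒2-approximate (allFin-unique _) (λ e → Vec.∈-toList⁺ (Vec.∈-allFin⁺ e))
                 (loop-run τ S 0 (allFin _)))
    -- For fixed `k` the quadratic bound is polynomial, the number of vertices being at most the
    -- input size.
    , (5 * k , 2 , λ S ≤k → ≤-trans (greedy-time≤ τ S k 1≤k ≤k)
        (≤-trans (≤-reflexive (sym (*-assoc 5 k _)))
          (*-monoʳ-≤ (5 * k) (^-monoˡ-≤ 2 (m≤m+n (#vertices S) _))))))
    , (5 , λ k 1≤k S ≤k → greedy-time≤ τ S k 1≤k ≤k) , greedy-Ω τ)
  -- No exploration exceeds the two leaves of the star.
  , blocking , ((optimalOnBlocking , refl) , size≤leaves blocking)
  -- No two windows tie in this run, so it computes to the same result for every `τ`.
  , λ τ → greedyOnBlocking , refl , refl
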